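{- Let $a$ be a nonnegative integer satisfying $a \le 66 - R_4(3)$, and let $q = a/24$. Then $R_n(3) \le n!(e-q)+1$ for all integers $n \ge 4$.
   Context: For an integer $n \ge 1$, the $n$-color Ramsey number $R_n(3) = R(3,\dots,3)$ denotes the smallest positive integer $N$ such that, for any coloring of the edges of the complete graph $K_N$ with $n$ colors, there is a monochromatic triangle. Here $e$ denotes the base of the natural logarithm. -}

module Defs where

open import Data.Nat using (ℕ; zero; suc; z≤n; s≤s; NonZero; _!)
import Data.Nat as ℕ
import Data.Nat.Properties as ℕ
open import Data.Nat.Solver using () renaming (module +-*-Solver to ℕS)
open import Data.Integer as ℤ using (+_)
import Data.Integer.Properties as ℤ
open import Data.Fin as Fin using (Fin; zero; suc; _<_; _<?_; punchOut; finToFun; funToFin)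
import Data.Fin.Properties as Fin
open import Data.Rational as ℚ using (ℚ; 0ℚ; 1ℚ; ½; _/_; ∣_∣)
import Data.Rational.Properties as ℚ
open import Data.Rational.Solver using (module +-*-Solver)
import Data.Rational.Unnormalised as ℚᵘ
import Data.Rational.Unnormalised.Properties as ℚᵘ
open import Data.Product using (Σ; ∃; _×_; _,_; proj₁; proj₂)
open import Data.Sum using (_⊎_; inj₁; inj₂)
open import Data.Empty using (⊥-elim; ⊥-elim-irr)
open import Relation.Nullary using (¬_; Dec; yes; no)
open import Relation.Nullary.Decidable using (map′; _×-dec_)
open import Relation.Unary using (Decidable)
open import Relation.Binary.PropositionalEquality
  using (_≡_; _≢_; refl; sym; trans; cong; cong₂; subst; subst₂)
open import Function using (_∘_)

-- An edge of K_N is a pair i < j of vertices.  The argument i < j is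
-- irrelevant, so that a colour depends on i and j only.
Coloring : (n N : ℕ) → Set
Coloring n N = (i j : Fin N) → .(i < j) → Fin n

MonoTriangle : ∀ {n N} → Coloring n N → Set
MonoTriangle {n} {N} c =
  ∃ λ (i : Fin N) → ∃ λ (j : Fin N) → ∃ λ (k : Fin N) →
  Σ (i < j) λ i<j → Σ (j < k) λ j<k →
    c i j i<j ≡ c j k j<k × c i j i<j ≡ c i k (Fin.<-trans i<j j<k)

Forces : (n N : ℕ) → Set
Forces n N = (c : Coloring n N) → MonoTriangle c

IsRamseyNumber : (n N : ℕ) → Set
IsRamseyNumber n N =
  1 ℕ.≤ N × Forces n N × (∀ M → 1 ℕ.≤ M → Forces n M → N ℕ.≤ M)

mono? : ∀ {n N} (c : Coloring n N) → Dec (MonoTriangle c)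
mono? {n} {N} c = Fin.any? λ i → Fin.any? λ j → Fin.any? λ k → triangle? i j k
  where
  triangle? : ∀ i j k → Dec (Σ (i < j) λ i<j → Σ (j < k) λ j<k →
    c i j i<j ≡ c j k j<k × c i j i<j ≡ c i k (Fin.<-trans i<j j<k))
  triangle? i j k with i <? j | j <? k
  ... | no i≮j | _ = no (i≮j ∘ proj₁)
  ... | yes _ | no j≮k = no (j≮k ∘ proj₁ ∘ proj₂)
  ... | yes p | yes q = map′ (λ r → p , q , r) (λ (_ , _ , r) → r)
    (c i j p Fin.≟ c j k q ×-dec c i j p Fin.≟ c i k (Fin.<-trans p q))

mono-resp : ∀ {n N} (c d : Coloring n N) →
  (∀ i j (p : i < j) → c i j p ≡ d i j p) → MonoTriangle c → MonoTriangle d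
mono-resp c d eq (i , j , k , p , q , r , s) = i , j , k , p , q ,
  trans (sym (eq i j p)) (trans r (eq j k q)) ,
  trans (sym (eq i j p)) (trans s (eq i k (Fin.<-trans p q)))

forces? : ∀ n N → Dec (Forces n N)
forces? zero 0 = no λ f → no-vertex (f λ ())
  where
  no-vertex : {c : Coloring 0 0} → ¬ MonoTriangle {0} {0} c
  no-vertex (() , _)
forces? zero 1 = no λ f → no-edge (f c₀)
  where
  c₀ : Coloring 0 1
  c₀ zero zero ()
  no-edge : ¬ MonoTriangle c₀
  no-edge (zero , zero , _ , () , _)
forces? zero (suc (suc N)) = yes λ c → ⊥-elim (Fin.¬Fin0 (c zero (suc zero) (s≤s z≤n)))
forces? (suc n) N = map′ to (λ f x → f (decode x)) (Fin.all? (mono? ∘ decode))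
  where
  decode : Fin ((suc n ℕ.^ N) ℕ.^ N) → Coloring (suc n) N
  decode x i j _ = finToFun (finToFun x i) j
  table : Coloring (suc n) N → Fin N → Fin N → Fin (suc n)
  table c i j with i <? j
  ... | yes p = c i j p
  ... | no _ = zero
  table-eq : ∀ c i j (p : i < j) → table c i j ≡ c i j p
  table-eq c i j p with i <? j
  ... | yes _ = refl
  ... | no i≮j = ⊥-elim (i≮j p)
  to : (∀ x → MonoTriangle (decode x)) → Forces (suc n) N
  to h c = mono-resp (decode x) c eq (h x)
    where
    x = funToFin (λ i → funToFin (table c i))
    eq : ∀ i j (p : i < j) → finToFun (finToFun x i) j ≡ c i j p
    eq i j p = trans
      (cong (λ y → finToFun y j) (Fin.finToFun-funToFin (λ i → funToFin (table c i)) i))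
      (trans (Fin.finToFun-funToFin (table c i) j) (table-eq c i j p))

record Embedding (a M : ℕ) : Set where
  field
    at   : Fin a → Fin M
    mono : ∀ {i j} → i < j → at i < at j
open Embedding public

private
  empty : ∀ {M} → Embedding 0 M
  empty .at ()
  empty .mono {()}

  shift : ∀ {a M} → Embedding a M → Embedding a (suc M)
  shift g .at i = suc (g .at i)
  shift g .mono p = s≤s (g .mono p)

  extend : ∀ {a M} → Embedding a M → Embedding (suc a) (suc M)
  extend g .at zero = zero
  extend g .at (suc i) = suc (g .at i)
  extend g .mono {zero} {suc j} _ = s≤s z≤n
  extend g .mono {suc i} {suc j} (s≤s p) = s≤s (g .mono p)

  compose : ∀ {a b c} → Embedding b c → Embedding a b → Embedding a c
  compose g h .at i = g .at (h .at i)
  compose g h .mono p = g .mono (h .mono p)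

  all-extend : ∀ {a M} {Q : Fin (suc M) → Set} (g : Embedding a M) →
    Q zero → (∀ i → Q (suc (g .at i))) → ∀ i → Q (extend g .at i)
  all-extend g q qs zero = q
  all-extend g q qs (suc i) = qs i

  split : ∀ {M} a d → a ℕ.+ d ℕ.≤ M → M ≢ 0 → {P : Fin M → Set} → Decidable P →
    (Σ (Embedding a M) λ g → ∀ i → P (g .at i)) ⊎
    (Σ (Embedding (suc d) M) λ g → ∀ i → ¬ P (g .at i))
  split zero d _ _ P? = inj₁ (empty , λ ())
  split {zero} (suc a) d _ M≢0 P? = ⊥-elim (M≢0 refl)
  split {suc M} (suc a) d (s≤s le) _ {P} P? with P? zero
  split {suc M} (suc a) zero _ _ {P} P? | no ¬p =
    inj₂ (extend empty , all-extend {Q = ¬_ ∘ P} empty ¬p λ ())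
  split {suc M} (suc a) (suc d) (s≤s le) _ {P} P? | no ¬p
    with split (suc a) d (subst (ℕ._≤ M) (ℕ.+-suc a d) le)
      (pos (subst (ℕ._≤ M) (ℕ.+-suc a d) le)) (P? ∘ suc)
    where
    pos : ∀ {k m} → suc k ℕ.≤ m → m ≢ 0
    pos () refl
  ... | inj₁ (g , h) = inj₁ (shift g , h)
  ... | inj₂ (g , h) = inj₂ (extend g , all-extend {Q = ¬_ ∘ P} g ¬p h)
  split {suc zero} (suc zero) d _ _ {P} P? | yes p =
    inj₁ (extend empty , all-extend {Q = P} empty p λ ())
  split {suc zero} (suc (suc a)) d (s≤s ()) _ P? | yes p
  split {suc (suc M)} (suc a) d (s≤s le) _ {P} P? | yes p
    with split a d le (λ ()) (P? ∘ suc)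
  ... | inj₁ (g , h) = inj₁ (extend g , all-extend {Q = P} g p h)
  ... | inj₂ (g , h) = inj₂ (shift g , h)

pigeonhole : ∀ n b (f : Fin (suc (n ℕ.* b)) → Fin n) →
  ∃ λ k → Σ (Embedding (suc b) (suc (n ℕ.* b))) λ g → ∀ i → f (g .at i) ≡ k
pigeonhole zero b f = ⊥-elim (Fin.¬Fin0 (f zero))
pigeonhole (suc n) b f
  with split (suc b) (n ℕ.* b) ℕ.≤-refl (λ ()) (λ i → zero Fin.≟ f i)
... | inj₁ (g , h) = zero , g , λ i → sym (h i)
... | inj₂ (g , h) with pigeonhole n b (λ i → punchOut (h i))
...   | k , g′ , h′ = suc k , compose g g′ , λ i →
        trans (sym (Fin.punchIn-punchOut (h (g′ .at i)))) (cong suc (h′ i))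

-- A vertex has suc b neighbours joined to it in the same colour.
forces-suc : ∀ n b → Forces n (suc b) →
  Forces (suc n) (2 ℕ.+ suc n ℕ.* b)
forces-suc n b F c with pigeonhole (suc n) b (λ j → c zero (suc j) (s≤s z≤n))
... | k , g , h = main
  where
  N = 2 ℕ.+ suc n ℕ.* b
  v : Embedding (suc b) N
  v = shift g
  restricted : Coloring (suc n) (suc b)
  restricted i j p = c (v .at i) (v .at j) (v .mono p)
  Hit : Fin (suc b) → Fin (suc b) → Set
  Hit i j = Σ (i < j) λ p → restricted i j p ≡ k
  hit? : ∀ i j → Dec (Hit i j)
  hit? i j with i <? j
  ... | no i≮j = no (i≮j ∘ proj₁)
  ... | yes p = map′ (p ,_) proj₂ (restricted i j p Fin.≟ k)
  main : MonoTriangle c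
  main with Fin.any? (λ i → Fin.any? (hit? i))
  ... | yes (i , j , p , eq) =
    zero , v .at i , v .at j , s≤s z≤n , v .mono p ,
    trans (h i) (sym eq) , trans (h i) (sym (h j))
  ... | no none = avoid (F λ i j p → punchOut (miss i j p))
    where
    miss : ∀ i j → .(p : i < j) → k ≢ restricted i j p
    miss i j p eq with i <? j
    ... | yes q = none (i , j , q , sym eq)
    ... | no i≮j = ⊥-elim-irr (i≮j p)
    avoid : MonoTriangle (λ i j p → punchOut (miss i j p)) → MonoTriangle c
    avoid (i , j , l , p , q , r , s) =
      v .at i , v .at j , v .at l , v .mono p , v .mono q ,
      Fin.punchOut-injective (miss i j p) (miss j l q) r ,
      Fin.punchOut-injective (miss i j p) (miss i l (Fin.<-trans p q)) s

forces-some : ∀ n → ∃ λ b → Forces n (suc b)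
forces-some zero = 1 , λ c → ⊥-elim (Fin.¬Fin0 (c zero (suc zero) (s≤s z≤n)))
forces-some (suc n) with forces-some n
... | b , F = suc (suc n ℕ.* b) , forces-suc n b F

private
  least : {P : ℕ → Set} → Decidable P → ∀ m → P m →
    ∃ λ k → P k × (∀ j → P j → k ℕ.≤ j)
  least P? m pm with P? zero
  ... | yes p0 = zero , p0 , λ _ _ → z≤n
  least P? zero pm | no ¬p0 = ⊥-elim (¬p0 pm)
  least P? (suc m) pm | no ¬p0 with least (P? ∘ suc) m pm
  ... | k , pk , k≤ = suc k , pk , λ where
    zero p0 → ⊥-elim (¬p0 p0)
    (suc j) pj → s≤s (k≤ j pj)

-- Abstract, so that the type checker never searches for R 4.
abstract
  ramseyNumber : ∀ n → ∃ (IsRamseyNumber n)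
  ramseyNumber n with forces-some n
  ... | b , F with least (forces? n ∘ suc) b F
  ...   | k , Fk , k≤ = suc k , s≤s z≤n , Fk , λ where
    (suc M) _ FM → s≤s (k≤ M FM)

-- R n = R(3,…,3) with n colours; proj₂ (ramseyNumber n) characterises it.
R : ℕ → ℕ
R n = proj₁ (ramseyNumber n)

IsCauchy : (ℕ → ℚ) → Set
IsCauchy s = ∀ ε → 0ℚ ℚ.< ε →
  ∃ λ N → ∀ m n → N ℕ.≤ m → N ℕ.≤ n → ∣ s m ℚ.- s n ∣ ℚ.≤ ε

-- Real numbers are represented by Cauchy sequences of rationals.
record ℝ : Set where
  constructor mkℝ
  field
    seq    : ℕ → ℚ
    cauchy : IsCauchy seq
open ℝ public

infix  4 _≤ᴿ_
infixl 6 _+ᴿ_ _-ᴿ_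
infixl 7 _*ᴿ_
infix  8 -ᴿ_

-- Distinct sequences may represent the same real, so the order allows
-- every positive error ε in the tail.
_≤ᴿ_ : ℝ → ℝ → Set
x ≤ᴿ y = ∀ ε → 0ℚ ℚ.< ε →
  ∃ λ N → ∀ n → N ℕ.≤ n → x .seq n ℚ.≤ y .seq n ℚ.+ ε

private
  open +-*-Solver using (solve; _:=_; _:+_; _:*_; _:-_; :-_)

  half-sum : ∀ ε → ½ ℚ.* ε ℚ.+ ½ ℚ.* ε ≡ ε
  half-sum ε = trans (sym (ℚ.*-distribʳ-+ ε ½ ½)) (ℚ.*-identityˡ ε)

  half-pos : ∀ {ε} → 0ℚ ℚ.< ε → 0ℚ ℚ.< ½ ℚ.* ε
  half-pos {ε} ε>0 = subst (ℚ._< ½ ℚ.* ε) (ℚ.*-zeroʳ ½) (ℚ.*-monoʳ-<-pos ½ ε>0)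

  ∣p∣≤ : ∀ {p d} → p ℚ.≤ d → ℚ.- p ℚ.≤ d → ∣ p ∣ ℚ.≤ d
  ∣p∣≤ {p} {d} p≤d -p≤d with ℚ.∣p∣≡p∨∣p∣≡-p p
  ... | inj₁ eq = subst (ℚ._≤ d) (sym eq) p≤d
  ... | inj₂ eq = subst (ℚ._≤ d) (sym eq) -p≤d

  within : ∀ {a d x y} → x ℚ.≤ a ℚ.+ d → a ℚ.≤ y → x ℚ.- y ℚ.≤ d
  within {a} {d} {x} {y} x≤ a≤y = subst (x ℚ.- y ℚ.≤_)
    (solve 2 (λ a d → (a :+ d) :- a := d) refl a d)
    (ℚ.+-mono-≤ x≤ (ℚ.neg-antimono-≤ a≤y))

  const-cauchy : ∀ q → IsCauchy (λ _ → q)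
  const-cauchy q ε ε>0 = 0 , λ _ _ _ _ →
    subst (λ z → ∣ z ∣ ℚ.≤ ε) (sym (ℚ.+-inverseʳ q)) (ℚ.<⇒≤ ε>0)

  neg-cauchy : ∀ {s} → IsCauchy s → IsCauchy (λ n → ℚ.- s n)
  neg-cauchy {s} cs ε ε>0 with cs ε ε>0
  ... | N , h = N , λ m n N≤m N≤n → subst (ℚ._≤ ε)
    (trans (sym (ℚ.∣-p∣≡∣p∣ (s m ℚ.- s n)))
      (cong ∣_∣ (ℚ.neg-distrib-+ (s m) (ℚ.- s n))))
    (h m n N≤m N≤n)

  add-cauchy : ∀ {s t} → IsCauchy s → IsCauchy t → IsCauchy (λ n → s n ℚ.+ t n)
  add-cauchy {s} {t} cs ct ε ε>0
    with cs (½ ℚ.* ε) (half-pos ε>0) | ct (½ ℚ.* ε) (half-pos ε>0)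
  ... | N , h | N′ , h′ = N ℕ.⊔ N′ , λ m n N≤m N≤n → begin
    ∣ (s m ℚ.+ t m) ℚ.- (s n ℚ.+ t n) ∣
      ≡⟨ cong ∣_∣ (solve 4 (λ a b c d → (a :+ b) :- (c :+ d) := (a :- c) :+ (b :- d))
           refl (s m) (t m) (s n) (t n)) ⟩
    ∣ (s m ℚ.- s n) ℚ.+ (t m ℚ.- t n) ∣
      ≤⟨ ℚ.∣p+q∣≤∣p∣+∣q∣ (s m ℚ.- s n) (t m ℚ.- t n) ⟩
    ∣ s m ℚ.- s n ∣ ℚ.+ ∣ t m ℚ.- t n ∣
      ≤⟨ ℚ.+-mono-≤
           (h m n (ℕ.m⊔n≤o⇒m≤o N N′ N≤m) (ℕ.m⊔n≤o⇒m≤o N N′ N≤n))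
           (h′ m n (ℕ.m⊔n≤o⇒n≤o N N′ N≤m) (ℕ.m⊔n≤o⇒n≤o N N′ N≤n)) ⟩
    ½ ℚ.* ε ℚ.+ ½ ℚ.* ε
      ≡⟨ half-sum ε ⟩
    ε ∎
    where open ℚ.≤-Reasoning

  bounded : ∀ {s} → IsCauchy s →
    ∃ λ B → ℚ.Positive B × ∃ λ N → ∀ n → N ℕ.≤ n → ∣ s n ∣ ℚ.≤ B
  bounded {s} cs with cs 1ℚ (ℚ.positive⁻¹ 1ℚ)
  ... | N , h = 1ℚ ℚ.+ ∣ s N ∣ ,
    ℚ.pos+nonNeg⇒pos 1ℚ ∣ s N ∣ {{ℚ.∣-∣-nonNeg (s N)}} , N , λ n N≤n → begin
    ∣ s n ∣
      ≡⟨ cong ∣_∣ (solve 2 (λ a b → a := (a :- b) :+ b) refl (s n) (s N)) ⟩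
    ∣ (s n ℚ.- s N) ℚ.+ s N ∣
      ≤⟨ ℚ.∣p+q∣≤∣p∣+∣q∣ (s n ℚ.- s N) (s N) ⟩
    ∣ s n ℚ.- s N ∣ ℚ.+ ∣ s N ∣
      ≤⟨ ℚ.+-monoˡ-≤ ∣ s N ∣ (h n N N≤n ℕ.≤-refl) ⟩
    1ℚ ℚ.+ ∣ s N ∣ ∎
    where open ℚ.≤-Reasoning

  ∣*∣-mono : ∀ p q {b d} → ∣ p ∣ ℚ.≤ b → ∣ q ∣ ℚ.≤ d → ∣ p ℚ.* q ∣ ℚ.≤ b ℚ.* d
  ∣*∣-mono p q {b} {d} p≤b q≤d = begin
    ∣ p ℚ.* q ∣     ≡⟨ ℚ.∣p*q∣≡∣p∣*∣q∣ p q ⟩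
    ∣ p ∣ ℚ.* ∣ q ∣ ≤⟨ ℚ.*-monoʳ-≤-nonNeg ∣ q ∣ {{ℚ.∣-∣-nonNeg q}} p≤b ⟩
    b ℚ.* ∣ q ∣     ≤⟨ ℚ.*-monoˡ-≤-nonNeg b {{ℚ.nonNegative (ℚ.≤-trans (ℚ.0≤∣p∣ p) p≤b)}} q≤d ⟩
    b ℚ.* d         ∎
    where open ℚ.≤-Reasoning

  telescope : ∀ x y z → (x ℚ.- y) ℚ.+ (y ℚ.- z) ≡ x ℚ.- z
  telescope x y z = trans (ℚ.+-assoc x (ℚ.- y) (y ℚ.- z))
    (cong (x ℚ.+_) (trans (sym (ℚ.+-assoc (ℚ.- y) y (ℚ.- z)))
      (trans (cong (ℚ._- z) (ℚ.+-inverseˡ y)) (ℚ.+-identityˡ (ℚ.- z)))))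

  product-diff : ∀ a b c d →
    a ℚ.* b ℚ.- c ℚ.* d ≡ a ℚ.* (b ℚ.- d) ℚ.+ (a ℚ.- c) ℚ.* d
  product-diff a b c d = sym (trans
    (cong₂ ℚ._+_
      (trans (ℚ.*-distribˡ-+ a b (ℚ.- d))
        (cong (a ℚ.* b ℚ.+_) (sym (ℚ.neg-distribʳ-* a d))))
      (trans (ℚ.*-distribʳ-+ d a (ℚ.- c))
        (cong (a ℚ.* d ℚ.+_) (sym (ℚ.neg-distribˡ-* c d)))))
    (telescope (a ℚ.* b) (a ℚ.* d) (c ℚ.* d)))

  product-close : ∀ a b c d {B C δ} → ∣ a ∣ ℚ.≤ B → ∣ d ∣ ℚ.≤ C →
    ∣ a ℚ.- c ∣ ℚ.≤ δ → ∣ b ℚ.- d ∣ ℚ.≤ δ →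
    ∣ a ℚ.* b ℚ.- c ℚ.* d ∣ ℚ.≤ (B ℚ.+ C) ℚ.* δ
  product-close a b c d {B} {C} {δ} a≤B d≤C ac bd = begin
    ∣ a ℚ.* b ℚ.- c ℚ.* d ∣
      ≡⟨ cong ∣_∣ (product-diff a b c d) ⟩
    ∣ a ℚ.* (b ℚ.- d) ℚ.+ (a ℚ.- c) ℚ.* d ∣
      ≤⟨ ℚ.∣p+q∣≤∣p∣+∣q∣ (a ℚ.* (b ℚ.- d)) ((a ℚ.- c) ℚ.* d) ⟩
    ∣ a ℚ.* (b ℚ.- d) ∣ ℚ.+ ∣ (a ℚ.- c) ℚ.* d ∣
      ≤⟨ ℚ.+-mono-≤ (∣*∣-mono a (b ℚ.- d) a≤B bd) (∣*∣-mono (a ℚ.- c) d ac d≤C) ⟩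
    B ℚ.* δ ℚ.+ δ ℚ.* C
      ≡⟨ cong (B ℚ.* δ ℚ.+_) (ℚ.*-comm δ C) ⟩
    B ℚ.* δ ℚ.+ C ℚ.* δ
      ≡⟨ sym (ℚ.*-distribʳ-+ δ B C) ⟩
    (B ℚ.+ C) ℚ.* δ ∎
    where open ℚ.≤-Reasoning

  divide : ∀ D → ℚ.Positive D → ∀ ε → 0ℚ ℚ.< ε → ∃ λ δ → 0ℚ ℚ.< δ × D ℚ.* δ ≡ ε
  divide D D>0 ε ε>0 = 1/D ℚ.* ε ,
    subst (ℚ._< 1/D ℚ.* ε) (ℚ.*-zeroʳ 1/D)
      (ℚ.*-monoʳ-<-pos 1/D {{ℚ.1/pos⇒pos D {{D>0}}}} ε>0) ,
    trans (sym (ℚ.*-assoc D 1/D ε))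
      (trans (cong (ℚ._* ε) (ℚ.*-inverseʳ D {{ℚ.pos⇒nonZero D {{D>0}}}})) (ℚ.*-identityˡ ε))
    where
    1/D = (ℚ.1/ D) {{ℚ.pos⇒nonZero D {{D>0}}}}

  mul-cauchy : ∀ {s t} → IsCauchy s → IsCauchy t → IsCauchy (λ n → s n ℚ.* t n)
  mul-cauchy {s} {t} cs ct ε ε>0 =
    let B , B>0 , K , sB = bounded {s} cs
        C , C>0 , K′ , tC = bounded {t} ct
        δ , δ>0 , D*δ = divide (B ℚ.+ C) (ℚ.pos+pos⇒pos B {{B>0}} C {{C>0}}) ε ε>0
        N , h = cs δ δ>0
        N′ , h′ = ct δ δ>0
    in (K ℕ.⊔ K′) ℕ.⊔ (N ℕ.⊔ N′) , λ m n ≤m ≤n →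
    let N≤m = ℕ.m⊔n≤o⇒n≤o (K ℕ.⊔ K′) (N ℕ.⊔ N′) ≤m
        N≤n = ℕ.m⊔n≤o⇒n≤o (K ℕ.⊔ K′) (N ℕ.⊔ N′) ≤n
        K≤m = ℕ.m⊔n≤o⇒m≤o (K ℕ.⊔ K′) (N ℕ.⊔ N′) ≤m
        K≤n = ℕ.m⊔n≤o⇒m≤o (K ℕ.⊔ K′) (N ℕ.⊔ N′) ≤n
    in subst (∣ s m ℚ.* t m ℚ.- s n ℚ.* t n ∣ ℚ.≤_) D*δ
      (product-close (s m) (t m) (s n) (t n)
        (sB m (ℕ.m⊔n≤o⇒m≤o K K′ K≤m)) (tC n (ℕ.m⊔n≤o⇒n≤o K K′ K≤n))
        (h m n (ℕ.m⊔n≤o⇒m≤o N N′ N≤m) (ℕ.m⊔n≤o⇒m≤o N N′ N≤n))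
        (h′ m n (ℕ.m⊔n≤o⇒n≤o N N′ N≤m) (ℕ.m⊔n≤o⇒n≤o N N′ N≤n)))

fromℚ : ℚ → ℝ
fromℚ q = mkℝ (λ _ → q) (const-cauchy q)

fromℕ : ℕ → ℝ
fromℕ n = fromℚ (+ n / 1)

-ᴿ_ : ℝ → ℝ
-ᴿ x = mkℝ (λ n → ℚ.- x .seq n) (neg-cauchy {x .seq} (x .cauchy))

_+ᴿ_ _-ᴿ_ _*ᴿ_ : ℝ → ℝ → ℝ
x +ᴿ y = mkℝ (λ n → x .seq n ℚ.+ y .seq n)
  (add-cauchy {x .seq} {y .seq} (x .cauchy) (y .cauchy))
x -ᴿ y = x +ᴿ (-ᴿ y)
x *ᴿ y = mkℝ (λ n → x .seq n ℚ.* y .seq n)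
  (mul-cauchy {x .seq} {y .seq} (x .cauchy) (y .cauchy))

1/_! : ℕ → ℚ
1/ k ! = (+ 1 / k !) {{k ℕ.!≢0}}

expSum : ℕ → ℚ
expSum zero    = 1/ 0 !
expSum (suc m) = expSum m ℚ.+ 1/ suc m !

recip-≤ : ∀ a F .{{_ : NonZero F}} → suc a ℕ.* suc (suc a) ℕ.≤ F →
  (+ 1 / F) ℚ.+ (+ 1 / suc (suc a)) ℚ.≤ + 1 / suc a
recip-≤ a (suc f) le = ℚ.toℚᵘ-cancel-≤ (begin
  ℚ.toℚᵘ ((+ 1 / F) ℚ.+ (+ 1 / suc (suc a)))
    ≃⟨ ℚ.toℚᵘ-homo-+ (+ 1 / F) (+ 1 / suc (suc a)) ⟩
  ℚ.toℚᵘ (+ 1 / F) ℚᵘ.+ ℚ.toℚᵘ (+ 1 / suc (suc a))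
    ≃⟨ ℚᵘ.+-cong (ℚ.toℚᵘ-fromℚᵘ (ℚᵘ.mkℚᵘ (+ 1) f))
         (ℚ.toℚᵘ-fromℚᵘ (ℚᵘ.mkℚᵘ (+ 1) (suc a))) ⟩
  ℚᵘ.mkℚᵘ (+ 1) f ℚᵘ.+ ℚᵘ.mkℚᵘ (+ 1) (suc a)
    ≤⟨ ℚᵘ.*≤* cross ⟩
  ℚᵘ.mkℚᵘ (+ 1) a
    ≃⟨ ℚᵘ.≃-sym (ℚ.toℚᵘ-fromℚᵘ (ℚᵘ.mkℚᵘ (+ 1) a)) ⟩
  ℚ.toℚᵘ (+ 1 / suc a) ∎)
  where
  open ℚᵘ.≤-Reasoning
  F = suc f
  nat : (1 ℕ.* suc (suc a) ℕ.+ 1 ℕ.* F) ℕ.* suc a ℕ.≤ 1 ℕ.* (F ℕ.* suc (suc a))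
  nat = subst₂ ℕ._≤_
    (ℕS.solve 2 (λ x F → x ℕS.:* (ℕS.con 1 ℕS.:+ x) ℕS.:+ F ℕS.:* x
      ℕS.:= (ℕS.con 1 ℕS.:* (ℕS.con 1 ℕS.:+ x) ℕS.:+ ℕS.con 1 ℕS.:* F) ℕS.:* x) refl (suc a) F)
    (ℕS.solve 2 (λ x F → F ℕS.:+ F ℕS.:* x
      ℕS.:= ℕS.con 1 ℕS.:* (F ℕS.:* (ℕS.con 1 ℕS.:+ x))) refl (suc a) F)
    (ℕ.+-monoˡ-≤ (F ℕ.* suc a) le)
  cross : (+ 1 ℤ.* + suc (suc a) ℤ.+ + 1 ℤ.* + F) ℤ.* + suc a ℤ.≤
          + 1 ℤ.* (+ (F ℕ.* suc (suc a)))
  cross = ℤ.+≤+ nat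

m≤m! : ∀ m → m ℕ.≤ m !
m≤m! zero = z≤n
m≤m! (suc m) = ℕ.≤-trans (ℕ.≤-reflexive (sym (ℕ.*-identityʳ (suc m))))
  (ℕ.*-monoʳ-≤ (suc m) (ℕ.1≤n! m))

expSum-mono : ∀ N j → expSum N ℚ.≤ expSum (j ℕ.+ N)
expSum-mono N zero = ℚ.≤-refl
expSum-mono N (suc j) = ℚ.≤-trans (expSum-mono N j)
  (subst (ℚ._≤ expSum (suc j ℕ.+ N)) (ℚ.+-identityʳ _)
    (ℚ.+-monoʳ-≤ (expSum (j ℕ.+ N)) (ℚ.nonNegative⁻¹ (1/ suc (j ℕ.+ N) !)
      {{ℚ.normalize-nonNeg 1 (suc (j ℕ.+ N) !) {{suc (j ℕ.+ N) ℕ.!≢0}}}})))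

-- expSum m + 1/m decreases for m ≥ 1
expSum-tail : ∀ a j →
  expSum (j ℕ.+ suc a) ℚ.+ (+ 1 / suc (j ℕ.+ a)) ℚ.≤ expSum (suc a) ℚ.+ (+ 1 / suc a)
expSum-tail a zero = ℚ.≤-refl
expSum-tail a (suc j) = ℚ.≤-trans
  (subst₂ ℚ._≤_ (sym (ℚ.+-assoc (expSum (j ℕ.+ suc a)) _ _)) refl
    (ℚ.+-monoʳ-≤ (expSum (j ℕ.+ suc a))
      (recip-≤ (j ℕ.+ a) (suc (j ℕ.+ suc a) !) {{suc (j ℕ.+ suc a) ℕ.!≢0}}
        (subst (λ k → suc (j ℕ.+ a) ℕ.* suc (suc (j ℕ.+ a)) ℕ.≤ suc k !)
          (sym (ℕ.+-suc j a))
          (subst (ℕ._≤ suc (suc (j ℕ.+ a)) !)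
            (ℕ.*-comm (suc (suc (j ℕ.+ a))) (suc (j ℕ.+ a)))
            (ℕ.*-monoʳ-≤ (suc (suc (j ℕ.+ a))) (m≤m! (suc (j ℕ.+ a)))))))))
  (expSum-tail a j)

expSum-lower : ∀ {N m} → N ℕ.≤ m → expSum N ℚ.≤ expSum m
expSum-lower {N} {m} N≤m =
  subst (λ k → expSum N ℚ.≤ expSum k) (ℕ.m∸n+n≡m N≤m) (expSum-mono N (m ℕ.∸ N))

expSum-upper : ∀ {a m} → suc a ℕ.≤ m → expSum m ℚ.≤ expSum (suc a) ℚ.+ (+ 1 / suc a)
expSum-upper {a} {m} le =
  subst (λ k → expSum k ℚ.≤ expSum (suc a) ℚ.+ (+ 1 / suc a)) (ℕ.m∸n+n≡m le)
    (ℚ.≤-trans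
      (subst (ℚ._≤ expSum (j ℕ.+ suc a) ℚ.+ r) (ℚ.+-identityʳ _)
        (ℚ.+-monoʳ-≤ (expSum (j ℕ.+ suc a))
          (ℚ.nonNegative⁻¹ r {{ℚ.normalize-nonNeg 1 (suc (j ℕ.+ a))}})))
      (expSum-tail a j))
  where
  j = m ℕ.∸ suc a
  r = + 1 / suc (j ℕ.+ a)

archimedean : ∀ ε → 0ℚ ℚ.< ε → ∃ λ a → + 1 / suc a ℚ.≤ ε
archimedean ε@(ℚ.mkℚ (+ suc p) d _) _ = d , ℚ.toℚᵘ-cancel-≤
  (ℚᵘ.≤-respˡ-≃ (ℚᵘ.≃-sym (ℚ.toℚᵘ-fromℚᵘ (ℚᵘ.mkℚᵘ (+ 1) d)))
    (ℚᵘ.*≤* (ℤ.+≤+ (ℕ.*-monoˡ-≤ (suc d) (s≤s (z≤n {p}))))))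
archimedean (ℚ.mkℚ (+ zero) d c) (ℚ.*<* (ℤ.+<+ ()))
archimedean (ℚ.mkℚ ℤ.-[1+ p ] d c) (ℚ.*<* ())

expSum-cauchy : IsCauchy expSum
expSum-cauchy ε ε>0 with archimedean ε ε>0
... | a , r≤ε = suc a , λ m n N≤m N≤n → ℚ.≤-trans
  (∣p∣≤ (within (expSum-upper N≤m) (expSum-lower N≤n))
    (subst (ℚ._≤ + 1 / suc a)
      (solve 2 (λ x y → y :- x := :- (x :- y)) refl (expSum m) (expSum n))
      (within (expSum-upper N≤n) (expSum-lower N≤m))))
  r≤ε

-- e = Σ 1/k! over k ≥ 0
e : ℝ
e = mkℝ expSum expSum-cauchy

{-# OPTIONS --safe #-}
-- For c n = R n − 1 the neighbourhood argument gives c (n+1) ≤ 1 + (n+1) c n, and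
-- n! (expSum n − q) satisfies the same recursion with equality.  At n = 4 we have
-- 4! expSum 4 = 65, so a ≤ 66 − R 4 says exactly c 4 ≤ 4! (expSum 4 − a/24).
module Submission where

open import Defs
open import Data.Nat using (ℕ; _≤_; _!)
open import Data.Integer using (+_) renaming (_≤_ to _≤ℤ_; _-_ to _-ℤ_)
open import Data.Rational using (_/_)

open import Data.Nat using (suc; _+_; _*_; pred; z≤n; s≤s; NonZero; >-nonZero; _≤′_; ≤′-reflexive; ≤′-step)
import Data.Nat.Properties as ℕ
open import Data.Integer using (+≤+) renaming (_*_ to _*ℤ_; _+_ to _+ℤ_; -_ to -ℤ_)
import Data.Integer.Properties as ℤ
open import Data.Rational as ℚ using (ℚ; 1ℚ; toℚᵘ)
import Data.Rational.Properties as ℚ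
import Data.Rational.Unnormalised as ℚᵘ
import Data.Rational.Unnormalised.Properties as ℚᵘ
open import Data.Product using (_,_; proj₁; proj₂)
open import Relation.Binary.PropositionalEquality

-- This is the constant term of the sequence `fromℕ k`, so inequalities between values of `ι` are
-- termwise inequalities between the reals in the theorem.
ι : ℕ → ℚ
ι k = + k / 1

-- A quotient in `ℚ` is reduced by a gcd, which is stuck on variables. Unnormalised fractions turn
-- the arithmetic of `ι` below into cross-multiplication of integers.
toℚᵘ-/ : ∀ m d → toℚᵘ (+ m / suc d) ℚᵘ.≃ ℚᵘ.mkℚᵘ (+ m) d
toℚᵘ-/ m d = ℚ.toℚᵘ-fromℚᵘ (ℚᵘ.mkℚᵘ (+ m) d)

ι-mono : ∀ {m n} → m ≤ n → ι m ℚ.≤ ι n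
ι-mono {m} {n} m≤n = ℚ.toℚᵘ-cancel-≤ (begin
  toℚᵘ (ι m)          ≃⟨ toℚᵘ-/ m 0 ⟩
  ℚᵘ.mkℚᵘ (+ m) 0     ≤⟨ ℚᵘ.*≤* (ℤ.*-monoʳ-≤-nonNeg (+ 1) (+≤+ m≤n)) ⟩
  ℚᵘ.mkℚᵘ (+ n) 0     ≃⟨ toℚᵘ-/ n 0 ⟨
  toℚᵘ (ι n)          ∎)
  where open ℚᵘ.≤-Reasoning

ι-+ : ∀ m n → ι (m + n) ≡ ι m ℚ.+ ι n
ι-+ m n = ℚ.toℚᵘ-injective (begin
  toℚᵘ (ι (m + n))                       ≈⟨ toℚᵘ-/ (m + n) 0 ⟩
  ℚᵘ.mkℚᵘ (+ (m + n)) 0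
    ≈⟨ ℚᵘ.*≡* (cong (_*ℤ + 1)
         (sym (cong₂ _+ℤ_ (ℤ.*-identityʳ (+ m)) (ℤ.*-identityʳ (+ n))))) ⟩
  ℚᵘ.mkℚᵘ (+ m) 0 ℚᵘ.+ ℚᵘ.mkℚᵘ (+ n) 0   ≈⟨ ℚᵘ.+-cong (toℚᵘ-/ m 0) (toℚᵘ-/ n 0) ⟨
  toℚᵘ (ι m) ℚᵘ.+ toℚᵘ (ι n)             ≈⟨ ℚ.toℚᵘ-homo-+ (ι m) (ι n) ⟨
  toℚᵘ (ι m ℚ.+ ι n)                     ∎)
  where open ℚᵘ.≃-Reasoning

ι-* : ∀ m n → ι (m * n) ≡ ι m ℚ.* ι n
ι-* m n = ℚ.toℚᵘ-injective (begin
  toℚᵘ (ι (m * n))                       ≈⟨ toℚᵘ-/ (m * n) 0 ⟩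
  ℚᵘ.mkℚᵘ (+ (m * n)) 0                  ≈⟨ ℚᵘ.*≡* (cong (_*ℤ + 1) (ℤ.pos-* m n)) ⟩
  ℚᵘ.mkℚᵘ (+ m) 0 ℚᵘ.* ℚᵘ.mkℚᵘ (+ n) 0   ≈⟨ ℚᵘ.*-cong (toℚᵘ-/ m 0) (toℚᵘ-/ n 0) ⟨
  toℚᵘ (ι m) ℚᵘ.* toℚᵘ (ι n)             ≈⟨ ℚ.toℚᵘ-homo-* (ι m) (ι n) ⟨
  toℚᵘ (ι m ℚ.* ι n)                     ∎)
  where open ℚᵘ.≃-Reasoning

ι-*-/ : ∀ m d .{{_ : NonZero d}} → ι d ℚ.* (+ m / d) ≡ ι m
ι-*-/ m (suc d) = ℚ.toℚᵘ-injective (begin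
  toℚᵘ (ι (suc d) ℚ.* (+ m / suc d))         ≈⟨ ℚ.toℚᵘ-homo-* (ι (suc d)) (+ m / suc d) ⟩
  toℚᵘ (ι (suc d)) ℚᵘ.* toℚᵘ (+ m / suc d)   ≈⟨ ℚᵘ.*-cong (toℚᵘ-/ (suc d) 0) (toℚᵘ-/ m d) ⟩
  ℚᵘ.mkℚᵘ (+ suc d) 0 ℚᵘ.* ℚᵘ.mkℚᵘ (+ m) d
    ≈⟨ ℚᵘ.*≡* (trans (ℤ.*-identityʳ _) (trans (ℤ.*-comm (+ suc d) (+ m))
         (cong (λ x → + m *ℤ + x) (sym (ℕ.+-identityʳ (suc d)))))) ⟩
  ℚᵘ.mkℚᵘ (+ m) 0                            ≈⟨ toℚᵘ-/ m 0 ⟨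
  toℚᵘ (ι m)                                 ∎)
  where open ℚᵘ.≃-Reasoning

ι-nonNeg : ∀ k → ℚ.NonNegative (ι k)
ι-nonNeg k = ℚ.normalize-nonNeg k 1

suc-pred-R : ∀ n → suc (pred (R n)) ≡ R n
suc-pred-R n = ℕ.suc-pred (R n) {{>-nonZero (proj₁ (proj₂ (ramseyNumber n)))}}

-- Since `R n` forces a triangle, `forces-suc` with `b = pred (R n)` yields a forcing size for one
-- more colour, and minimality of `R (suc n)` bounds it by that size.
R-suc : ∀ n → pred (R (suc n)) ≤ 1 + suc n * pred (R n)
R-suc n = ℕ.pred-mono-≤ (least (2 + suc n * pred (R n)) (s≤s z≤n)
  (forces-suc n (pred (R n)) (subst (Forces n) (sym (suc-pred-R n)) forces)))
  where
  forces = proj₁ (proj₂ (proj₂ (ramseyNumber n)))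
  least = proj₂ (proj₂ (proj₂ (ramseyNumber (suc n))))

-- The last summand of `expSum (suc n)` times the factorial gives the 1. The factor `suc n` splits
-- off the rest, whatever constant `q` is.
expSum-suc : ∀ n q →
  ι (suc n !) ℚ.* (expSum (suc n) ℚ.- q) ≡ 1ℚ ℚ.+ ι (suc n) ℚ.* (ι (n !) ℚ.* (expSum n ℚ.- q))
expSum-suc n q = begin
  F ℚ.* ((expSum n ℚ.+ r) ℚ.- q)
    ≡⟨ cong (F ℚ.*_) (trans (cong (ℚ._- q) (ℚ.+-comm (expSum n) r))
         (ℚ.+-assoc r (expSum n) (ℚ.- q))) ⟩
  F ℚ.* (r ℚ.+ (expSum n ℚ.- q))
    ≡⟨ ℚ.*-distribˡ-+ F r (expSum n ℚ.- q) ⟩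
  F ℚ.* r ℚ.+ F ℚ.* (expSum n ℚ.- q)
    ≡⟨ cong₂ ℚ._+_ (ι-*-/ 1 (suc n !) {{suc n ℕ.!≢0}})
         (trans (cong (ℚ._* (expSum n ℚ.- q)) (ι-* (suc n) (n !)))
           (ℚ.*-assoc (ι (suc n)) (ι (n !)) (expSum n ℚ.- q))) ⟩
  1ℚ ℚ.+ ι (suc n) ℚ.* (ι (n !) ℚ.* (expSum n ℚ.- q)) ∎
  where
  open ≡-Reasoning
  F = ι (suc n !)
  r = 1/ suc n !

R-bound-suc : ∀ n q → ι (pred (R n)) ℚ.≤ ι (n !) ℚ.* (expSum n ℚ.- q) →
  ι (pred (R (suc n))) ℚ.≤ ι (suc n !) ℚ.* (expSum (suc n) ℚ.- q)
R-bound-suc n q h = begin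
  ι (pred (R (suc n)))
    ≤⟨ ι-mono (R-suc n) ⟩
  ι (1 + suc n * pred (R n))
    ≡⟨ trans (ι-+ 1 (suc n * pred (R n))) (cong (1ℚ ℚ.+_) (ι-* (suc n) (pred (R n)))) ⟩
  1ℚ ℚ.+ ι (suc n) ℚ.* ι (pred (R n))
    ≤⟨ ℚ.+-monoʳ-≤ 1ℚ (ℚ.*-monoˡ-≤-nonNeg (ι (suc n)) {{ι-nonNeg (suc n)}} h) ⟩
  1ℚ ℚ.+ ι (suc n) ℚ.* (ι (n !) ℚ.* (expSum n ℚ.- q))
    ≡⟨ expSum-suc n q ⟨
  ι (suc n !) ℚ.* (expSum (suc n) ℚ.- q) ∎
  where open ℚ.≤-Reasoning

R-bound-4 : ∀ a → + a ≤ℤ + 66 -ℤ + R 4 →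
  ι (pred (R 4)) ℚ.≤ ι (4 !) ℚ.* (expSum 4 ℚ.- (+ a / 24))
R-bound-4 a a≤ = begin
  ι c                                     ≡⟨ ℚ.+-identityʳ (ι c) ⟨
  ι c ℚ.+ ι 0                             ≡⟨ cong (ι c ℚ.+_) (ℚ.+-inverseʳ (ι a)) ⟨
  ι c ℚ.+ (ι a ℚ.- ι a)                   ≡⟨ ℚ.+-assoc (ι c) (ι a) (ℚ.- ι a) ⟨
  (ι c ℚ.+ ι a) ℚ.- ι a                   ≡⟨ cong (ℚ._- ι a) (ι-+ c a) ⟨
  -- The bound 66 drops to 65 because `c` is one less than `R 4`.
  ι (c + a) ℚ.- ι a                       ≤⟨ ℚ.+-monoˡ-≤ (ℚ.- ι a) (ι-mono (ℕ.pred-mono-≤ c+a<66)) ⟩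
  -- By evaluation 24 (1 + 1 + 1/2 + 1/6 + 1/24) = 65, so only the term with `a` needs rewriting.
  ι 65 ℚ.- ι a                            ≡⟨ cong (λ x → ι 65 ℚ.- x) (ι-*-/ a 24) ⟨
  ι 24 ℚ.* expSum 4 ℚ.- ι 24 ℚ.* (+ a / 24)
    ≡⟨ cong (ι 24 ℚ.* expSum 4 ℚ.+_) (ℚ.neg-distribʳ-* (ι 24) (+ a / 24)) ⟩
  ι 24 ℚ.* expSum 4 ℚ.+ ι 24 ℚ.* (ℚ.- (+ a / 24))
    ≡⟨ ℚ.*-distribˡ-+ (ι 24) (expSum 4) (ℚ.- (+ a / 24)) ⟨
  ι 24 ℚ.* (expSum 4 ℚ.- (+ a / 24))      ∎
  where
  open ℚ.≤-Reasoning
  c = pred (R 4)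
  -- Adding `R 4` to both sides removes the subtraction, so that the inequality descends to
  -- naturals.
  a+R≤66 : + a +ℤ + R 4 ≤ℤ + 66
  a+R≤66 = subst (+ a +ℤ + R 4 ≤ℤ_)
    (trans (ℤ.+-assoc (+ 66) (-ℤ + R 4) (+ R 4))
      (cong (+ 66 +ℤ_) (ℤ.+-inverseˡ (+ R 4))))
    (ℤ.+-monoˡ-≤ (+ R 4) a≤)
  c+a<66 : suc (c + a) ≤ 66
  c+a<66 = subst (_≤ 66) (trans (ℕ.+-comm a (R 4)) (cong (_+ a) (sym (suc-pred-R 4))))
    (ℤ.drop‿+≤+ a+R≤66)

-- Induction on `≤′` starts at 4 and raises the upper end by one, matching `R-bound-suc`.
R-bound : ∀ a → + a ≤ℤ + 66 -ℤ + R 4 → ∀ {n} → 4 ≤′ n →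
  ι (pred (R n)) ℚ.≤ ι (n !) ℚ.* (expSum n ℚ.- (+ a / 24))
R-bound a a≤ (≤′-reflexive refl) = R-bound-4 a a≤
R-bound a a≤ (≤′-step {n} 4≤n)   = R-bound-suc n (+ a / 24) (R-bound a a≤ 4≤n)

proposition2p7 : (a : ℕ) → + a ≤ℤ + 66 -ℤ + R 4 →
    ∀ n → 4 ≤ n →
    fromℕ (R n) ≤ᴿ fromℕ (n !) *ᴿ (e -ᴿ fromℚ (+ a / 24)) +ᴿ fromℕ 1
-- From index `n` on, the partial sums of e are at least `expSum n`, for which `R-bound` holds.
proposition2p7 a a≤ n 4≤n ε ε>0 = n , λ m n≤m → begin
  ι (R n)
    ≡⟨ cong ι (trans (sym (suc-pred-R n)) (ℕ.+-comm 1 (pred (R n)))) ⟩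
  ι (pred (R n) + 1)
    ≡⟨ ι-+ (pred (R n)) 1 ⟩
  ι (pred (R n)) ℚ.+ 1ℚ
    ≤⟨ ℚ.+-monoˡ-≤ 1ℚ (R-bound a a≤ (ℕ.≤⇒≤′ 4≤n)) ⟩
  ι (n !) ℚ.* (expSum n ℚ.- q) ℚ.+ 1ℚ
    ≤⟨ ℚ.+-monoˡ-≤ 1ℚ (ℚ.*-monoˡ-≤-nonNeg (ι (n !)) {{ι-nonNeg (n !)}}
         (ℚ.+-monoˡ-≤ (ℚ.- q) (expSum-lower n≤m))) ⟩
  ι (n !) ℚ.* (expSum m ℚ.- q) ℚ.+ 1ℚ
    -- The bound already holds without error; `ε` is added only to meet the definition of `_≤ᴿ_`.
    ≡⟨ ℚ.+-identityʳ _ ⟨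
  ι (n !) ℚ.* (expSum m ℚ.- q) ℚ.+ 1ℚ ℚ.+ ι 0
    ≤⟨ ℚ.+-monoʳ-≤ (ι (n !) ℚ.* (expSum m ℚ.- q) ℚ.+ 1ℚ) (ℚ.<⇒≤ ε>0) ⟩
  ι (n !) ℚ.* (expSum m ℚ.- q) ℚ.+ 1ℚ ℚ.+ ε ∎
  where
  open ℚ.≤-Reasoning
  q = + a / 24
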